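{- Let $\mathcal{R}$ be a finite commutative ring with $1$ of characteristic $2$, meaning that $1+1=0$ in $\mathcal{R}$, and let $m\ge 1$. Then $\mathcal{I}(\mathcal{R},m)=|\mathcal{R}|^m$.
   Context: For $u,v\in\mathcal{R}^m$ let $d^2(u,v)=\sum_{i=1}^m(u_i-v_i)^2\in\mathcal{R}$. Two points are at integral distance if $d^2(u,v)=t^2$ for some $t\in\mathcal{R}$. An integral point set in $\mathcal{R}^m$ is a set of points pairwise at integral distance. For finite $\mathcal{R}$, $\mathcal{I}(\mathcal{R},m)$ denotes the maximum cardinality of an integral point set in $\mathcal{R}^m$. -}

module Defs where

open import Algebra.Bundles using (CommutativeRing)
import Algebra.Properties.Semiring.Exp
import Algebra.Properties.Semiring.Sum
open import Data.Fin.Base using (Fin)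
open import Data.Nat.Base using (ℕ; _≤_)
open import Data.Product.Base using (Σ; ∃; _×_; proj₁)
open import Data.Vec.Functional using (Vector)
import Data.Vec.Functional.Relation.Binary.Equality.Setoid as VecEq
open import Function.Bundles using (Bijection)
open import Level using (Level; _⊔_) renaming (suc to lsuc)
open import Relation.Binary.Bundles using (Setoid)
import Relation.Binary.Construct.On as On
open import Relation.Binary.Definitions using (_Respects_)
import Relation.Binary.PropositionalEquality.Properties as ≡
open import Relation.Unary using (Pred; _∈_)

private variable
  a ℓ p : Level

HasCardinality : Setoid a ℓ → ℕ → Set (a ⊔ ℓ)
HasCardinality S n = Bijection (≡.setoid (Fin n)) S

subsetoid : (S : Setoid a ℓ) → Pred (Setoid.Carrier S) p → Setoid (a ⊔ p) ℓ
subsetoid S P = On.setoid {B = Σ (Setoid.Carrier S) P} S proj₁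

IsMaximumOf : Pred ℕ p → ℕ → Set p
IsMaximumOf P k = k ∈ P × (∀ j → j ∈ P → j ≤ k)

module IntegralDistance {c ℓ} (R : CommutativeRing c ℓ) where

  open CommutativeRing R
  open Algebra.Properties.Semiring.Exp semiring using (_^_)
  open Algebra.Properties.Semiring.Sum semiring using (sum-syntax)

  Point : ℕ → Set c
  Point m = Vector Carrier m

  pointSetoid : ℕ → Setoid c ℓ
  pointSetoid m = VecEq.≋-setoid setoid m

  d² : ∀ {m} → Point m → Point m → Carrier
  d² {m} u v = ∑[ i < m ] ((u i - v i) ^ 2)

  AtIntegralDistance : ∀ {m} → Point m → Point m → Set (c ⊔ ℓ)
  AtIntegralDistance u v = ∃ λ t → d² u v ≈ t ^ 2

  -- Membership at level ℓ loses no finite set: the set enumerated by f is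
  -- λ u → ∃ λ i → u ≋ f i.
  record IntegralPointSet (m : ℕ) : Set (c ⊔ lsuc ℓ) where
    field
      Member   : Pred (Point m) ℓ
      resp     : Member Respects (Setoid._≈_ (pointSetoid m))
      integral : ∀ {u v} → u ∈ Member → v ∈ Member → AtIntegralDistance u v

  HasIntegralPointSetOfSize : (m : ℕ) → Pred ℕ (c ⊔ lsuc ℓ)
  HasIntegralPointSetOfSize m k =
    Σ (IntegralPointSet m) λ P →
      HasCardinality (subsetoid (pointSetoid m) (IntegralPointSet.Member P)) k

-- The relation 𝓘 R m k reads "𝓘(R, m) = k"; k is unique, as maxima in ℕ are.
𝓘 : ∀ {c ℓ} → CommutativeRing c ℓ → ℕ → ℕ → Set (c ⊔ lsuc ℓ)
𝓘 R m k = IsMaximumOf (IntegralDistance.HasIntegralPointSetOfSize R m) k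

{-# OPTIONS --safe #-}

-- In characteristic 2 squaring is additive, so d²(u, v) is the square of
-- Σ (uᵢ - vᵢ). Hence any two points are at integral distance, and the whole
-- space Rᵐ is an integral point set.
module Submission where

open import Defs
open import Algebra.Bundles using (CommutativeRing)
open import Data.Nat.Base using (ℕ; _≤_; _^_)

open import Algebra.Bundles using (CommutativeSemiring)
import Algebra.Properties.Semiring.Exp
import Algebra.Properties.Semiring.Sum
import Algebra.Solver.Ring.NaturalCoefficients.Default
open import Data.Fin.Base using (Fin; zero; suc; finToFun; funToFin)
open import Data.Fin.Properties
  using (injective⇒≤; finToFun-funToFin; funToFin-finToFin)
open import Data.Nat.Base using (zero; suc)
open import Data.Product.Base using (_,_; proj₁)
open import Data.Unit.Polymorphic.Base using (⊤; tt)
open import Data.Vec.Functional using (Vector; head; tail)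
import Data.Vec.Functional.Relation.Binary.Equality.Setoid as VecEq
open import Function.Base using (_∘_; id)
open import Function.Bundles using (Bijection; Injection; Inverse)
import Function.Construct.Composition as Composition
open import Function.Properties.Bijection using (Bijection⇒Inverse)
open import Function.Properties.Inverse
  using (Inverse⇒Bijection; Inverse⇒Injection)
  renaming (sym to inverse-sym)
open import Level using (Level)
open import Relation.Binary.Bundles using (Setoid)
open import Relation.Binary.PropositionalEquality.Core as ≡ using (_≡_)
open import Relation.Unary using (Pred)

-- Let `n` be the size of the ring. The bound `n ^ m` is attained because Frobenius is additive: by
-- `sum-squares`, the sum of the `u i - v i` is a square root of `d² u v`, so the whole space is an
-- integral point set, and `HasCardinality-vector` counts it. Nothing larger exists, since every
-- integral point set injects into the space (`HasCardinality-injection⇒≤`).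

private variable
  a b ℓ ℓ′ p : Level

-- Pointwise equality does not yield `f ≡ g` without function extensionality, so `≡.cong` cannot be
-- used.
funToFin-cong : ∀ {m n} {f g : Fin m → Fin n} →
                (∀ i → f i ≡ g i) → funToFin f ≡ funToFin g
funToFin-cong {zero}  f≗g = ≡.refl
funToFin-cong {suc m} f≗g
  rewrite f≗g zero | funToFin-cong (f≗g ∘ suc) = ≡.refl

-- A vector over `S` becomes a function `Fin m → Fin n` coordinate by coordinate, and `funToFin`
-- encodes that function as a number in base `n`.
HasCardinality-vector : ∀ (S : Setoid a ℓ) {n} → HasCardinality S n →
                        ∀ m → HasCardinality (VecEq.≋-setoid S m) (n ^ m)
HasCardinality-vector S {n} S-card m = Inverse⇒Bijection record
  { to        = λ k → to ∘ finToFun {n} {m} k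
  ; from      = λ u → funToFin (from ∘ u)
  ; to-cong   = λ { ≡.refl i → S.refl }
  ; from-cong = λ u≋v → funToFin-cong (from-cong ∘ u≋v)
  ; inverse   =
      (λ { {u} ≡.refl i → inverseˡ (finToFun-funToFin (from ∘ u) i) })
    , (λ {k} u≋ → ≡.trans (funToFin-cong (inverseʳ ∘ u≋))
                          (funToFin-finToFin {m} {n} k))
  }
  where
  module S = Setoid S
  open Inverse (Bijection⇒Inverse S-card)

-- Inverting the enumeration of `T` gives a composite injection from `Fin j` through `S` and `T` to
-- `Fin k`; the pigeonhole principle finishes.
HasCardinality-injection⇒≤ :
  ∀ {S : Setoid a ℓ} {T : Setoid b ℓ′} {j k} →
  HasCardinality S j → HasCardinality T k → Injection S T → j ≤ k
HasCardinality-injection⇒≤ S-card T-card S↣T =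
  injective⇒≤ (Injection.injective
    (Composition.injection (Bijection.injection S-card)
      (Composition.injection S↣T
        (Inverse⇒Injection (inverse-sym (Bijection⇒Inverse T-card))))))

-- Equality in `subsetoid S P` is by definition equality of first components, so both proofs are
-- `id`.
subsetoid-injection : ∀ (S : Setoid a ℓ) (P : Pred (Setoid.Carrier S) p) →
                      Injection (subsetoid S P) S
subsetoid-injection S P = record { to = proj₁ ; cong = id ; injective = id }

HasCardinality-universal : ∀ {S : Setoid a ℓ} {n} → HasCardinality S n →
                           HasCardinality (subsetoid {p = p} S (λ _ → ⊤)) n
HasCardinality-universal S-card = record
  { to        = λ k → to k , tt
  ; cong      = cong
  ; bijective = injective , λ (x , _) → surjective x
  }
  where open Bijection S-card

module Characteristic2 {c ℓ} (S : CommutativeSemiring c ℓ) where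

  open CommutativeSemiring S
  open Algebra.Properties.Semiring.Exp semiring
    using () renaming (_^_ to _^ˢ_)
  open Algebra.Properties.Semiring.Sum semiring using (sum; sum-syntax)
  open Algebra.Solver.Ring.NaturalCoefficients.Default S
    using (solve; _:=_; _:+_; _:*_; con)
  open import Relation.Binary.Reasoning.Setoid setoid

  square-+ : 1# + 1# ≈ 0# → ∀ x y → (x + y) ^ˢ 2 ≈ x ^ˢ 2 + y ^ˢ 2
  square-+ 1+1≈0 x y = begin
    (x + y) ^ˢ 2
      -- Squares are written with `con 1` because `x ^ˢ 2` unfolds to `x * (x * 1#)`. The cross term
      -- is isolated as a multiple of `1# + 1#`.
      ≈⟨ solve 2 (λ x y →
           (x :+ y) :* ((x :+ y) :* con 1) :=
           (x :* (x :* con 1) :+ y :* (y :* con 1))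
             :+ (con 1 :+ con 1) :* (x :* y)) refl x y ⟩
    (x ^ˢ 2 + y ^ˢ 2) + (1# + 1#) * (x * y)  ≈⟨ +-congˡ (*-congʳ 1+1≈0) ⟩
    (x ^ˢ 2 + y ^ˢ 2) + 0# * (x * y)         ≈⟨ +-congˡ (zeroˡ _) ⟩
    (x ^ˢ 2 + y ^ˢ 2) + 0#                   ≈⟨ +-identityʳ _ ⟩
    x ^ˢ 2 + y ^ˢ 2                          ∎

  sum-squares : 1# + 1# ≈ 0# → ∀ {m} (u : Vector Carrier m) →
                ∑[ i < m ] (u i ^ˢ 2) ≈ sum u ^ˢ 2
  -- The empty sum is `0#`, and its square unfolds to `0# * (0# * 1#)`.
  sum-squares 1+1≈0 {zero}  u = sym (zeroˡ _)
  sum-squares 1+1≈0 {suc m} u = begin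
    head u ^ˢ 2 + ∑[ i < m ] (tail u i ^ˢ 2)  ≈⟨ +-congˡ (sum-squares 1+1≈0 (tail u)) ⟩
    head u ^ˢ 2 + sum (tail u) ^ˢ 2           ≈⟨ square-+ 1+1≈0 _ _ ⟨
    sum u ^ˢ 2                                ∎

lemma2 : ∀ {c ℓ} (R : CommutativeRing c ℓ) (n : ℕ) →
    let open CommutativeRing R in
    HasCardinality setoid n →
    1# + 1# ≈ 0# →
    ∀ m → 1 ≤ m → 𝓘 R m (n ^ m)
lemma2 R n R-card 1+1≈0 m _ =
    (wholeSpace , HasCardinality-universal points-card)
  , λ j (P , P-card) → HasCardinality-injection⇒≤ P-card points-card
      (subsetoid-injection (pointSetoid m) (IntegralPointSet.Member P))
  where
  open CommutativeRing R
  open IntegralDistance R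
  open Characteristic2 commutativeSemiring

  points-card : HasCardinality (pointSetoid m) (n ^ m)
  points-card = HasCardinality-vector setoid R-card m

  wholeSpace : IntegralPointSet m
  wholeSpace = record
    { Member   = λ _ → ⊤
    ; resp     = λ _ → id
    -- The omitted witness is `sum (λ i → u i - v i)`.
    ; integral = λ {u} {v} _ _ → _ , sum-squares 1+1≈0 (λ i → u i - v i)
    }
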